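{- Let $M$ be a $\lambda$-term, $\Gamma$ an environment and $\sigma$ a linear rank 2 intersection type. If $\mathsf{T}(M) = (\Gamma,\sigma)$, then $\Gamma \vdash_2 M : \sigma$.
   Context: Terms are untyped $\lambda$-terms modulo $\alpha$-equivalence, with Barendregt's variable convention. $M[N/x]$ is the usual substitution, and $M[N_1/x_1,\dots,N_n/x_n]$ means the successive substitutions $(\dots(M[N_1/x_1])\dots)[N_n/x_n]$. **Types.** $\mathbb{V}$ is a countably infinite set of type variables. Linear types: $\mathbb{T}_{L0}$ is the least set with $\mathbb{T}_{L0}=\mathbb{V}\cup\{\tau_1\multimap\tau_2 \mid \tau_1,\tau_2\in\mathbb{T}_{L0}\}$. Sequences: $\mathbb{T}_{L1}=\{\tau_1\cap\dots\cap\tau_m\mid m\ge 1,\ \tau_i\in\mathbb{T}_{L0}\}$. Linear rank 2 intersection types: $\mathbb{T}_{L2}$ is the least set with $\mathbb{T}_{L2}=\mathbb{T}_{L0}\cup\{\tau\multimap\sigma\mid\tau\in\mathbb{T}_{L0},\sigma\in\mathbb{T}_{L2}\}\cup\{\tau_1\cap\dots\cap\tau_m\to\sigma\mid m\ge2,\tau_i\in\mathbb{T}_{L0},\sigma\in\mathbb{T}_{L2}\}$. The constructor $\cap$ is associative, commutative and non-idempotent. Below $\alpha$ ranges over $\mathbb{V}$, $\tau$ over $\mathbb{T}_{L0}$, $\vec\tau$ over $\mathbb{T}_{L1}$, $\sigma$ over $\mathbb{T}_{L2}$. **Environments.** An environment is a finite list $\Gamma=[x_1:\vec\tau_1,\dots,x_n:\vec\tau_n]$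 with pairwise distinct term variables $x_i$ (consistency); $\mathrm{dom}(\Gamma)=\{x_1,\dots,x_n\}$, $\Gamma(x_i)=\vec\tau_i$. The comma denotes concatenation of lists. $\Gamma_x$ is $\Gamma$ with the declaration of $x$ (if any) removed. $\Gamma_1+\Gamma_2$ is the environment with domain $\mathrm{dom}(\Gamma_1)\cup\mathrm{dom}(\Gamma_2)$ given by $\Gamma_1(x)$ if $x\notin\mathrm{dom}(\Gamma_2)$, $\Gamma_2(x)$ if $x\notin\mathrm{dom}(\Gamma_1)$, and $\Gamma_1(x)\cap\Gamma_2(x)$ otherwise, listing first the variables of $\Gamma_1$ in their order, then those of $\mathrm{dom}(\Gamma_2)\setminus\mathrm{dom}(\Gamma_1)$ in the order of $\Gamma_2$; $\sum$ is iterated $+$. **Linear Rank 2 Intersection Type System.** $\Gamma\vdash_2 M:\sigma$ is derived by the following rules (all lists occurring must be environments): - (Axiom) $[x:\tau]\vdash_2 x:\tau$. - (Exchange) from $\Gamma_1,x:\vec\tau_1,y:\vec\tau_2,\Gamma_2\vdash_2 M:\sigma$ infer $\Gamma_1,y:\vec\tau_2,x:\vec\tau_1,\Gamma_2\vdash_2 M:\sigma$. - (Contraction) from $\Gamma_1,x_1:\vec\tau_1,x_2:\vec\tau_2,\Gamma_2\vdash_2 M:\sigma$ infer $\Gamma_1,x:\vec\tau_1\cap\vec\tau_2,\Gamma_2\vdash_2 M[x/x_1,x/x_2]:\sigma$. - ($\to$ Intro) from $\Gamma,x:\tau_1\cap\dots\cap\tau_n\vdash_2 M:\sigma$ with $n\ge2$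 infer $\Gamma\vdash_2\lambda x.M:\tau_1\cap\dots\cap\tau_n\to\sigma$. - ($\to$ Elim) from $\Gamma\vdash_2 M_1:\tau_1\cap\dots\cap\tau_n\to\sigma$ and $\Gamma_i\vdash_2 M_2:\tau_i$ for $1\le i\le n$, with $n\ge2$, infer $\Gamma,\sum_{i=1}^n\Gamma_i\vdash_2 M_1M_2:\sigma$. - ($\multimap$ Intro) from $\Gamma,x:\tau\vdash_2 M:\sigma$ infer $\Gamma\vdash_2\lambda x.M:\tau\multimap\sigma$. - ($\multimap$ Elim) from $\Gamma_1\vdash_2 M_1:\tau\multimap\sigma$ and $\Gamma_2\vdash_2 M_2:\tau$ infer $\Gamma_1,\Gamma_2\vdash_2 M_1M_2:\sigma$. **Type substitutions and unification.** A type substitution $\mathbb{S}=[\tau_1/\alpha_1,\dots,\tau_n/\alpha_n]$ (distinct $\alpha_i$, $\tau_i\in\mathbb{T}_{L0}$) acts by simultaneous replacement on types, sequences and (componentwise) environments. A unification problem $P$ is a finite set of equations between types of $\mathbb{T}_{L0}$. The relation $\Rightarrow$ is: $\{\tau=\tau\}\cup P\Rightarrow P$; $\{\tau_1\multimap\tau_2=\tau_3\multimap\tau_4\}\cup P\Rightarrow\{\tau_1=\tau_3,\tau_2=\tau_4\}\cup P$; $\{\tau_1\multimap\tau_2=\alpha\}\cup P\Rightarrow\{\alpha=\tau_1\multimap\tau_2\}\cup P$; $\{\alpha=\tau\}\cup P\Rightarrow\{\alpha=\tau\}\cup P[\tau/\alpha]$ if $\alpha$ occurs in $P$ and not in $\tau$;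 $\{\alpha=\tau\}\cup P\Rightarrow\mathsf{FAIL}$ if $\alpha$ occurs in $\tau$ and $\alpha\ne\tau$. $\mathsf{UNIFY}(P)$ applies $\Rightarrow$ as long as possible; if the result is a solved form $\{\alpha_1=\tau_1,\dots,\alpha_n=\tau_n\}$ ($\alpha_i$ pairwise distinct, occurring in no $\tau_j$) it returns $[\tau_1/\alpha_1,\dots,\tau_n/\alpha_n]$ (a most general unifier of the original problem), otherwise it fails. **Type inference algorithm $\mathsf{T}$.** "New" type variables are fresh; separate recursive calls use different fresh variables; results are considered up to renaming of type variables. 1. $\mathsf{T}(x)=([x:\alpha],\alpha)$, $\alpha$ new. 2. If $M=\lambda x.M_1$ and $\mathsf{T}(M_1)=(\Gamma_1,\sigma_1)$: (a) if $x\notin\mathrm{dom}(\Gamma_1)$, fail; (b) if $(x:\tau)\in\Gamma_1$, $\mathsf{T}(M)=((\Gamma_1)_x,\tau\multimap\sigma_1)$; (c) if $(x:\tau_1\cap\dots\cap\tau_n)\in\Gamma_1$ with $n\ge2$, $\mathsf{T}(M)=((\Gamma_1)_x,\tau_1\cap\dots\cap\tau_n\to\sigma_1)$. 3. If $M=M_1M_2$: (a) if $\mathsf{T}(M_1)=(\Gamma_1,\alpha_1)$ and $\mathsf{T}(M_2)=(\Gamma_2,\tau_2)$, then $\mathsf{T}(M)=(\mathbb{S}(\Gamma_1+\Gamma_2),\mathbb{S}(\alpha_3))$ with $\mathbb{S}=\mathsf{UNIFY}(\{\alpha_1=\alpha_2\multimap\alpha_3,\tau_2=\alpha_2\})$,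 $\alpha_2,\alpha_3$ new; (b) if $\mathsf{T}(M_1)=(\Gamma_1',\tau_1'\cap\dots\cap\tau_n'\to\sigma_1')$ with $n\ge2$ and, for each $1\le i\le n$, $\mathsf{T}(M_2)=(\Gamma_i,\tau_i)$ ($n$ separate calls, whose results may differ by renaming of type variables), then $\mathsf{T}(M)=(\mathbb{S}(\Gamma_1'+\sum_{i=1}^n\Gamma_i),\mathbb{S}(\sigma_1'))$ with $\mathbb{S}=\mathsf{UNIFY}(\{\tau_i=\tau_i'\mid1\le i\le n\})$; (c) if $\mathsf{T}(M_1)=(\Gamma_1,\tau\multimap\sigma_1)$ and $\mathsf{T}(M_2)=(\Gamma_2,\tau_2)$, then $\mathsf{T}(M)=(\mathbb{S}(\Gamma_1+\Gamma_2),\mathbb{S}(\sigma_1))$ with $\mathbb{S}=\mathsf{UNIFY}(\{\tau_2=\tau\})$; (d) otherwise fail. If a recursive call or a unification fails, the algorithm fails. $\mathsf{T}(M)=(\Gamma,\sigma)$ means that the algorithm succeeds with this result. -}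

module Defs where

open import Data.Nat using (ℕ; suc; _≟_)
open import Data.Fin using (Fin; fromℕ; inject₁; lift) renaming (suc to fsuc)
open import Data.List using (List; []; _∷_; _++_; map; filter; foldr; concatMap; zipWith; length)
open import Data.List.NonEmpty as List⁺ using (List⁺; _∷_; [_]; _∷⁺_; _⁺++⁺_; toList)
open import Data.List.Membership.Propositional using (_∈_; _∉_)
open import Data.List.Membership.DecPropositional _≟_ using (_∉?_)
open import Data.List.Relation.Binary.BagAndSetEquality using (_∼[_]_; set)
open import Data.List.Relation.Binary.Permutation.Propositional using (_↭_)
open import Data.List.Relation.Binary.Pointwise using (Pointwise)
open import Data.List.Relation.Unary.All using (All)
open import Data.List.Relation.Unary.Any using (Any)
open import Data.List.Relation.Unary.Unique.Propositional using (Unique)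
open import Data.Maybe using (Maybe; just; nothing; maybe′)
open import Data.Product using (_×_; _,_; proj₁; proj₂; ∃-syntax)
open import Data.Sum using (_⊎_)
open import Relation.Binary.Construct.Closure.ReflexiveTransitive using (Star)
open import Relation.Binary.PropositionalEquality using (_≡_; _≢_)
open import Relation.Nullary using (¬_; yes; no; ¬?)

------------------------------------------------------------------------
-- Terms

Name TVar : Set
Name = ℕ
TVar = ℕ

-- λ-terms modulo α-equivalence, in locally nameless style: free variables
-- are names, bound variables are de Bruijn indices.  λ-terms proper have no
-- dangling index.
data Term (n : ℕ) : Set where
  free  : Name → Term n
  bound : Fin n → Term n
  lam   : Term (suc n) → Term n
  _·_   : Term n → Term n → Term n

infixl 7 _·_

Λ : Set
Λ = Term 0

-- The new index is the largest one, i.e. it refers to a binder placed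
-- outside all n binders already in scope.
close : ∀ {n} → Name → Term n → Term (suc n)
close {n} x (free y) with x ≟ y
... | yes _ = bound (fromℕ n)
... | no  _ = free y
close x (bound i) = bound (inject₁ i)
close x (lam M)   = lam (close x M)
close x (M · N)   = close x M · close x N

-- λx.M as an operation on α-classes.  Every abstraction is ƛ x ∙ M for each
-- x not free in it, so the variable convention can always be met.
ƛ_∙_ : Name → Λ → Λ
ƛ x ∙ M = lam (close x M)

infixr 6 ƛ_∙_

rename : ∀ {m n} → (Fin m → Fin n) → Term m → Term n
rename ρ (free x)  = free x
rename ρ (bound i) = bound (ρ i)
rename ρ (lam M)   = lam (rename (lift 1 ρ) M)
rename ρ (M · N)   = rename ρ M · rename ρ N

infixl 8 _[_/_]

_[_/_] : ∀ {n} → Term n → Term n → Name → Term n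
free y [ N / x ] with x ≟ y
... | yes _ = N
... | no  _ = free y
bound i   [ N / x ] = bound i
lam M     [ N / x ] = lam (M [ rename fsuc N / x ])
(M₁ · M₂) [ N / x ] = M₁ [ N / x ] · M₂ [ N / x ]

------------------------------------------------------------------------
-- Types

infixr 6 _⊸_ _∩_⟶_

data T₀ : Set where
  tv  : TVar → T₀
  _⊸_ : T₀ → T₀ → T₀

-- Non-empty sequences τ₁ ∩ … ∩ τₘ.  Listing the components builds in
-- associativity; commutativity is the relation ≈₁ below.
T₁ : Set
T₁ = List⁺ T₀

-- The same set as 𝕋_L0 ∪ {τ ⊸ σ} ∪ {τ₁ ∩ … ∩ τₘ → σ ∣ m ≥ 2}, presented so
-- that every type is generated in one way only: 𝕋_L0 sits inside through ⌊_⌋.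
-- In τ ∩ τ⃗ ⟶ σ the sequence is τ ∷⁺ τ⃗; it has at least two components.
data T₂ : Set where
  tv    : TVar → T₂
  _⊸_   : T₀ → T₂ → T₂
  _∩_⟶_ : T₀ → T₁ → T₂ → T₂

⌊_⌋ : T₀ → T₂
⌊ tv α ⌋    = tv α
⌊ τ₁ ⊸ τ₂ ⌋ = τ₁ ⊸ ⌊ τ₂ ⌋

infix 4 _≈₁_ _≈₂_ _≈ₑ_

_≈₁_ : T₁ → T₁ → Set
τ⃗ ≈₁ τ⃗′ = toList τ⃗ ↭ toList τ⃗′

-- Equality of types: commutativity of ∩ below the constructors.
data _≈₂_ : T₂ → T₂ → Set where
  tv    : ∀ {α} → tv α ≈₂ tv α
  _⊸_   : ∀ τ {σ σ′} → σ ≈₂ σ′ → τ ⊸ σ ≈₂ τ ⊸ σ′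
  _∩⟶_  : ∀ {τ τ⃗ τ′ τ⃗′ σ σ′} → τ ∷⁺ τ⃗ ≈₁ τ′ ∷⁺ τ⃗′ → σ ≈₂ σ′ →
          τ ∩ τ⃗ ⟶ σ ≈₂ τ′ ∩ τ⃗′ ⟶ σ′

------------------------------------------------------------------------
-- Environments

Decl : Set
Decl = Name × T₁

infix 4 _∶_
pattern _∶_ x τ⃗ = x , τ⃗

Env : Set
Env = List Decl

dom : Env → List Name
dom = map proj₁

-- Lists of declarations are environments when they are consistent.
Consistent : Env → Set
Consistent Γ = Unique (dom Γ)

_≈ₑ_ : Env → Env → Set
_≈ₑ_ = Pointwise λ where (x ∶ τ⃗) (y ∶ τ⃗′) → x ≡ y × τ⃗ ≈₁ τ⃗′

lookup : Env → Name → Maybe T₁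
lookup []            x = nothing
lookup ((y ∶ τ⃗) ∷ Γ) x with x ≟ y
... | yes _ = just τ⃗
... | no  _ = lookup Γ x

infixl 6 _∖_ _⊕_

_∖_ : Env → Name → Env
Γ ∖ x = filter (λ d → ¬? (x ≟ proj₁ d)) Γ

-- Γ₁ + Γ₂
_⊕_ : Env → Env → Env
Γ₁ ⊕ Γ₂ = map (λ where (x ∶ τ⃗) → x ∶ maybe′ (τ⃗ ⁺++⁺_) τ⃗ (lookup Γ₂ x)) Γ₁
          ++ filter (λ d → proj₁ d ∉? dom Γ₁) Γ₂

⨁ : List Env → Env
⨁ = foldr _⊕_ []

------------------------------------------------------------------------
-- The linear rank 2 intersection type system

infix 3 _⊢₂_∶_

-- Consistency of the conclusion is required in the rules where it does not
-- follow from consistency of the premises.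
data _⊢₂_∶_ : Env → Λ → T₂ → Set where

  axiom : ∀ {x τ} →
    (x ∶ [ τ ]) ∷ [] ⊢₂ free x ∶ ⌊ τ ⌋

  exchange : ∀ {Γ₁ Γ₂ x y τ⃗₁ τ⃗₂ M σ} →
    Γ₁ ++ (x ∶ τ⃗₁) ∷ (y ∶ τ⃗₂) ∷ Γ₂ ⊢₂ M ∶ σ →
    Γ₁ ++ (y ∶ τ⃗₂) ∷ (x ∶ τ⃗₁) ∷ Γ₂ ⊢₂ M ∶ σ

  contraction : ∀ {Γ₁ Γ₂ x₁ x₂ x τ⃗₁ τ⃗₂ M σ} →
    Γ₁ ++ (x₁ ∶ τ⃗₁) ∷ (x₂ ∶ τ⃗₂) ∷ Γ₂ ⊢₂ M ∶ σ →
    Consistent (Γ₁ ++ (x ∶ τ⃗₁ ⁺++⁺ τ⃗₂) ∷ Γ₂) →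
    Γ₁ ++ (x ∶ τ⃗₁ ⁺++⁺ τ⃗₂) ∷ Γ₂ ⊢₂ M [ free x / x₁ ] [ free x / x₂ ] ∶ σ

  →-intro : ∀ {Γ x τ τ⃗ M σ} →
    Γ ++ (x ∶ τ ∷⁺ τ⃗) ∷ [] ⊢₂ M ∶ σ →
    Γ ⊢₂ ƛ x ∙ M ∶ τ ∩ τ⃗ ⟶ σ

  →-elim : ∀ {Γ Γs τ τ⃗ M₁ M₂ σ} →
    Γ ⊢₂ M₁ ∶ τ ∩ τ⃗ ⟶ σ →
    Pointwise (λ Γᵢ τᵢ → Γᵢ ⊢₂ M₂ ∶ ⌊ τᵢ ⌋) Γs (toList (τ ∷⁺ τ⃗)) →
    Consistent (Γ ++ ⨁ Γs) →
    Γ ++ ⨁ Γs ⊢₂ M₁ · M₂ ∶ σ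

  ⊸-intro : ∀ {Γ x τ M σ} →
    Γ ++ (x ∶ [ τ ]) ∷ [] ⊢₂ M ∶ σ →
    Γ ⊢₂ ƛ x ∙ M ∶ τ ⊸ σ

  ⊸-elim : ∀ {Γ₁ Γ₂ τ M₁ M₂ σ} →
    Γ₁ ⊢₂ M₁ ∶ τ ⊸ σ →
    Γ₂ ⊢₂ M₂ ∶ ⌊ τ ⌋ →
    Consistent (Γ₁ ++ Γ₂) →
    Γ₁ ++ Γ₂ ⊢₂ M₁ · M₂ ∶ σ

  -- Not a rule of the calculus: types that differ by commutativity of ∩ are
  -- the same type.
  types-mod-≈ : ∀ {Γ Γ′ M σ σ′} →
    Γ ≈ₑ Γ′ → σ ≈₂ σ′ →
    Γ  ⊢₂ M ∶ σ →
    Γ′ ⊢₂ M ∶ σ′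

------------------------------------------------------------------------
-- Type substitutions

-- The entry (α , τ) stands for τ/α.
TSubst : Set
TSubst = List (TVar × T₀)

infixr 8 _$ᵥ_ _$₀_ _$₁_ _$₂_ _$ₑ_

_$ᵥ_ : TSubst → TVar → T₀
[]            $ᵥ β = tv β
((α , τ) ∷ S) $ᵥ β with α ≟ β
... | yes _ = τ
... | no  _ = S $ᵥ β

_$₀_ : TSubst → T₀ → T₀
S $₀ tv α      = S $ᵥ α
S $₀ (τ₁ ⊸ τ₂) = S $₀ τ₁ ⊸ S $₀ τ₂

_$₁_ : TSubst → T₁ → T₁
S $₁ τ⃗ = List⁺.map (S $₀_) τ⃗

_$₂_ : TSubst → T₂ → T₂
S $₂ tv α         = ⌊ S $ᵥ α ⌋
S $₂ (τ ⊸ σ)      = S $₀ τ ⊸ S $₂ σ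
S $₂ (τ ∩ τ⃗ ⟶ σ) = S $₀ τ ∩ S $₁ τ⃗ ⟶ S $₂ σ

_$ₑ_ : TSubst → Env → Env
S $ₑ Γ = map (λ where (x ∶ τ⃗) → x ∶ S $₁ τ⃗) Γ

------------------------------------------------------------------------
-- Unification

infix 5 _≐_

data Equation : Set where
  _≐_ : T₀ → T₀ → Equation

-- Read as finite sets, i.e. only up to _∼[ set ]_.
Problem : Set
Problem = List Equation

data _OccursIn_ (α : TVar) : T₀ → Set where
  here  : α OccursIn tv α
  left  : ∀ {τ₁ τ₂} → α OccursIn τ₁ → α OccursIn (τ₁ ⊸ τ₂)
  right : ∀ {τ₁ τ₂} → α OccursIn τ₂ → α OccursIn (τ₁ ⊸ τ₂)

_OccursInEq_ : TVar → Equation → Set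
α OccursInEq (τ₁ ≐ τ₂) = α OccursIn τ₁ ⊎ α OccursIn τ₂

_OccursInProblem_ : TVar → Problem → Set
α OccursInProblem P = Any (α OccursInEq_) P

substProblem : T₀ → TVar → Problem → Problem
substProblem τ α = map λ where
  (τ₁ ≐ τ₂) → ((α , τ) ∷ []) $₀ τ₁ ≐ ((α , τ) ∷ []) $₀ τ₂

-- R = {e} ∪ P as a disjoint union, so that no rule below can keep the
-- equation it rewrites as a second copy of itself.
_≋_∪_ : Problem → Equation → Problem → Set
R ≋ e ∪ P = R ∼[ set ] (e ∷ P) × e ∉ P

State : Set
State = Maybe Problem

pattern FAIL = nothing

infix 4 _⇒_ _≋_∪_

data _⇒_ : State → State → Set where

  delete : ∀ {R P τ} →
    R ≋ τ ≐ τ ∪ P →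
    just R ⇒ just P

  decompose : ∀ {R P τ₁ τ₂ τ₃ τ₄} →
    R ≋ τ₁ ⊸ τ₂ ≐ τ₃ ⊸ τ₄ ∪ P →
    just R ⇒ just ((τ₁ ≐ τ₃) ∷ (τ₂ ≐ τ₄) ∷ P)

  orient : ∀ {R P τ₁ τ₂ α} →
    R ≋ τ₁ ⊸ τ₂ ≐ tv α ∪ P →
    just R ⇒ just ((tv α ≐ τ₁ ⊸ τ₂) ∷ P)

  eliminate : ∀ {R P α τ} →
    R ≋ tv α ≐ τ ∪ P →
    α OccursInProblem P → ¬ (α OccursIn τ) →
    just R ⇒ just ((tv α ≐ τ) ∷ substProblem τ α P)

  occurs-check : ∀ {R P α τ} →
    R ≋ tv α ≐ τ ∪ P →
    α OccursIn τ → tv α ≢ τ →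
    just R ⇒ FAIL

equations : TSubst → Problem
equations = map λ where (α , τ) → tv α ≐ τ

Solved : TSubst → Set
Solved S = Unique (map proj₁ S)
         × (∀ {α τ} → α ∈ map proj₁ S → τ ∈ map proj₂ S → ¬ (α OccursIn τ))

-- No rule applies to a solved form, so a rewriting sequence that reaches one
-- has been carried on as long as possible.
UNIFY_↦_ : Problem → TSubst → Set
UNIFY P ↦ S = ∃[ Q ] Star _⇒_ (just P) (just Q) × Q ∼[ set ] equations S × Solved S

infix 4 UNIFY_↦_

------------------------------------------------------------------------
-- Type inference

-- Outcome of one call on an argument: the type variables it created, and the
-- environment and (linear) type it returned.
Call : Set
Call = List TVar × Env × T₀

vars : Call → List TVar
vars (V , _ , _) = V

env : Call → Env
env (_ , Γ , _) = Γ

type : Call → T₀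
type (_ , _ , τ) = τ

-- Infer V M Γ σ: a run of the algorithm on M that creates the type variables
-- V returns (Γ , σ).  Freshness is the requirement that no type variable be
-- created twice.  The choice of names is otherwise arbitrary, so the results
-- are closed under renaming of type variables.  Failing runs have no result.
data Infer : List TVar → Λ → Env → T₂ → Set where

  var : ∀ {x α} →
    Infer (α ∷ []) (free x) ((x ∶ [ tv α ]) ∷ []) (tv α)

  abs-⊸ : ∀ {V x M₁ Γ₁ σ₁ τ} →
    Infer V M₁ Γ₁ σ₁ →
    (x ∶ [ τ ]) ∈ Γ₁ →
    Infer V (ƛ x ∙ M₁) (Γ₁ ∖ x) (τ ⊸ σ₁)

  abs-→ : ∀ {V x M₁ Γ₁ σ₁ τ τ⃗} →
    Infer V M₁ Γ₁ σ₁ →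
    (x ∶ τ ∷⁺ τ⃗) ∈ Γ₁ →
    Infer V (ƛ x ∙ M₁) (Γ₁ ∖ x) (τ ∩ τ⃗ ⟶ σ₁)

  app-var : ∀ {V₁ V₂ M₁ M₂ Γ₁ Γ₂ α₁ α₂ α₃ τ₂ S} →
    Infer V₁ M₁ Γ₁ (tv α₁) →
    Infer V₂ M₂ Γ₂ ⌊ τ₂ ⌋ →
    Unique (α₂ ∷ α₃ ∷ V₁ ++ V₂) →
    UNIFY (tv α₁ ≐ tv α₂ ⊸ tv α₃) ∷ (τ₂ ≐ tv α₂) ∷ [] ↦ S →
    Infer (α₂ ∷ α₃ ∷ V₁ ++ V₂) (M₁ · M₂) (S $ₑ (Γ₁ ⊕ Γ₂)) (S $₂ tv α₃)

  app-→ : ∀ {V₁ M₁ M₂ Γ₁ τ τ⃗ σ₁ S} {calls : List Call} →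
    Infer V₁ M₁ Γ₁ (τ ∩ τ⃗ ⟶ σ₁) →
    length calls ≡ List⁺.length (τ ∷⁺ τ⃗) →
    All (λ c → Infer (vars c) M₂ (env c) ⌊ type c ⌋) calls →
    Unique (V₁ ++ concatMap vars calls) →
    UNIFY zipWith _≐_ (map type calls) (toList (τ ∷⁺ τ⃗)) ↦ S →
    Infer (V₁ ++ concatMap vars calls) (M₁ · M₂)
          (S $ₑ (Γ₁ ⊕ ⨁ (map env calls))) (S $₂ σ₁)

  app-⊸ : ∀ {V₁ V₂ M₁ M₂ Γ₁ Γ₂ τ σ₁ τ₂ S} →
    Infer V₁ M₁ Γ₁ (τ ⊸ σ₁) →
    Infer V₂ M₂ Γ₂ ⌊ τ₂ ⌋ →
    Unique (V₁ ++ V₂) →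
    UNIFY (τ₂ ≐ τ) ∷ [] ↦ S →
    Infer (V₁ ++ V₂) (M₁ · M₂) (S $ₑ (Γ₁ ⊕ Γ₂)) (S $₂ σ₁)

  -- As in the type system: results are taken up to commutativity of ∩.
  types-mod-≈ : ∀ {V M Γ Γ′ σ σ′} →
    Γ ≈ₑ Γ′ → σ ≈₂ σ′ →
    Infer V M Γ  σ →
    Infer V M Γ′ σ′

infix 3 𝖳⟨_⟩≡⟨_,_⟩

𝖳⟨_⟩≡⟨_,_⟩ : Λ → Env → T₂ → Set
𝖳⟨ M ⟩≡⟨ Γ , σ ⟩ = ∃[ V ] Infer V M Γ σ

{-# OPTIONS --safe #-}
module Submission where

open import Data.List using (List; []; _∷_; _++_; map; filter; zipWith; length)
open import Data.List.Extrema.Nat using (max; xs≤max)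
open import Data.List.Membership.Propositional using (_∈_; _∉_)
open import Data.List.Membership.Propositional.Properties
  using (∈-map⁺; ∈-map⁻; ∈-++⁺ˡ; ∈-++⁺ʳ; ∈-++⁻; ∈-∃++; ∈-filter⁻)
open import Data.List.NonEmpty using (_∷_; _∷⁺_; _⁺++⁺_; toList)
open import Data.List.NonEmpty.Properties using (map-⁺++⁺)
open import Data.List.Properties
  using (map-++; map-∘; map-cong; map-cong-local; map-id; ++-assoc; ++-identityʳ;
         filter-++; filter-all; filter-accept; filter-reject)
open import Data.List.Relation.Binary.Permutation.Propositional
  using (_↭_; refl; prep; swap; trans; ↭-trans; ↭⇒↭ₛ)
open import Data.List.Relation.Binary.Permutation.Propositional.Properties
  using (shift; ++⁺ˡ; ∷↭∷ʳ)
  renaming (map⁺ to ↭-map⁺)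
open import Data.List.Relation.Binary.Permutation.Setoid.Properties using (Unique-resp-↭)
open import Data.List.Relation.Binary.Pointwise using (Pointwise; []; _∷_)
open import Data.List.Relation.Unary.All as All using (All; []; _∷_)
import Data.List.Relation.Unary.AllPairs as AllPairs
import Data.List.Relation.Unary.AllPairs.Properties as AllPairs
open import Data.List.Relation.Unary.Any using (here; there)
open import Data.List.Relation.Unary.Unique.Propositional using (Unique; []; _∷_)
import Data.List.Relation.Unary.Unique.Propositional.Properties as Unique
open import Data.Maybe as Maybe using (just; nothing; maybe′)
open import Data.Nat using (ℕ; suc; _+_; _≤_; _<_; _≟_; _≤?_; s≤s)
open import Data.Nat.Properties using (+-cancelˡ-≡; m≤m+n; <⇒≱; suc-injective)
open import Data.Product using (_×_; _,_; proj₁; proj₂; ∃-syntax)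
open import Data.Sum as Sum using (_⊎_; inj₁; inj₂)
open import Function using (_∘_; id; Equivalence)
open import Function.Definitions using (Injective)
open import Relation.Binary.Construct.Closure.ReflexiveTransitive using (Star; ε; _◅_)
open import Relation.Binary.PropositionalEquality
  using (_≡_; _≢_; refl; sym; cong; cong₂; subst; subst₂; setoid; module ≡-Reasoning)
  renaming (trans to ≡-trans)
open import Relation.Nullary using (¬_; Dec; yes; no; ¬?; contradiction)
open import Relation.Nullary.Decidable using (_×-dec_; _⊎-dec_)

open import Data.List.Membership.DecPropositional _≟_ using (_∈?_; _∉?_)

open import Defs

-- By induction on the run of the algorithm.  Derivations are stable under type
-- substitutions, and a unifier returned by UNIFY solves the original equations,
-- so after applying it the types of function and argument match.  What remains
-- is that the elimination rules concatenate environments while the algorithm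
-- adds them.  Derivations are also stable under injective renamings ρ of the
-- free variables; choosing ρ to move the variables shared by Γ₁ and Γ₂ away
-- makes Γ₁ ++ ρ Γ₂ consistent, the elimination rule types M₁ · ρ M₂, and one
-- contraction for each shared variable turns this into Γ₁ ⊕ Γ₂ and M₁ · M₂.

-- Renaming of free variables

names : ∀ {n} → Term n → List Name
names (free x)  = x ∷ []
names (bound i) = []
names (lam M)   = names M
names (M · N)   = names M ++ names N

-- `f` may be any function: injective ones transport whole derivations, while the collapsing ones
-- express the variable substitutions made by contraction.
relabel : ∀ {n} → (Name → Name) → Term n → Term n
relabel f (free x)  = free (f x)
relabel f (bound i) = bound i
relabel f (lam M)   = lam (relabel f M)
relabel f (M · N)   = relabel f M · relabel f N

relabel-cong-local : ∀ {n f g} (M : Term n) → (∀ {z} → z ∈ names M → f z ≡ g z) →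
                     relabel f M ≡ relabel g M
relabel-cong-local (free x)  eq = cong free (eq (here refl))
relabel-cong-local (bound i) eq = refl
relabel-cong-local (lam M)   eq = cong lam (relabel-cong-local M eq)
relabel-cong-local (M · N)   eq =
  cong₂ _·_ (relabel-cong-local M (eq ∘ ∈-++⁺ˡ)) (relabel-cong-local N (eq ∘ ∈-++⁺ʳ (names M)))

relabel-cong : ∀ {n f g} (M : Term n) → (∀ z → f z ≡ g z) → relabel f M ≡ relabel g M
relabel-cong M eq = relabel-cong-local M λ {z} _ → eq z

relabel-id : ∀ {n} (M : Term n) → relabel id M ≡ M
relabel-id (free x)  = refl
relabel-id (bound i) = refl
relabel-id (lam M)   = cong lam (relabel-id M)
relabel-id (M · N)   = cong₂ _·_ (relabel-id M) (relabel-id N)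

relabel-id-local : ∀ {n f} (M : Term n) → (∀ {z} → z ∈ names M → f z ≡ z) → relabel f M ≡ M
relabel-id-local M eq = ≡-trans (relabel-cong-local M eq) (relabel-id M)

relabel-∘ : ∀ {n} f g (M : Term n) → relabel f (relabel g M) ≡ relabel (f ∘ g) M
relabel-∘ f g (free x)  = refl
relabel-∘ f g (bound i) = refl
relabel-∘ f g (lam M)   = cong lam (relabel-∘ f g M)
relabel-∘ f g (M · N)   = cong₂ _·_ (relabel-∘ f g M) (relabel-∘ f g N)

-- Without injectivity another free name could be sent to `ρ x`, and the closing on the right would
-- capture it.
relabel-close : ∀ {n ρ} → Injective _≡_ _≡_ ρ → ∀ x (M : Term n) →
                relabel ρ (close x M) ≡ close (ρ x) (relabel ρ M)
relabel-close {ρ = ρ} inj x (free y) with x ≟ y | ρ x ≟ ρ y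
... | yes _   | yes _     = refl
... | yes x≡y | no ρx≢ρy  = contradiction (cong ρ x≡y) ρx≢ρy
... | no x≢y  | yes ρx≡ρy = contradiction (inj ρx≡ρy) x≢y
... | no _    | no _      = refl
relabel-close inj x (bound i) = refl
relabel-close inj x (lam M)   = cong lam (relabel-close inj x M)
relabel-close inj x (M · N)   = cong₂ _·_ (relabel-close inj x M) (relabel-close inj x N)

infix 9 _↤_

-- The substitution `[ free y / x ]` as a function on names, so that successive substitutions become
-- composed functions.
_↤_ : Name → Name → Name → Name
(y ↤ x) z with x ≟ z
... | yes _ = y
... | no  _ = z

↤-hit : ∀ y x → (y ↤ x) x ≡ y
↤-hit y x with x ≟ x
... | yes _  = refl
... | no x≢x = contradiction refl x≢x

↤-miss : ∀ y {x z} → x ≢ z → (y ↤ x) z ≡ z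
↤-miss y {x} {z} x≢z with x ≟ z
... | yes x≡z = contradiction x≡z x≢z
... | no _    = refl

↤-self : ∀ x z → (x ↤ x) z ≡ z
↤-self x z with x ≟ z
... | yes x≡z = x≡z
... | no _    = refl

[/]-relabel : ∀ {n} x y (M : Term n) → M [ free y / x ] ≡ relabel (y ↤ x) M
[/]-relabel x y (free z) with x ≟ z
... | yes _ = refl
... | no  _ = refl
[/]-relabel x y (bound i) = refl
[/]-relabel x y (lam M)   = cong lam ([/]-relabel x y M)
[/]-relabel x y (M · N)   = cong₂ _·_ ([/]-relabel x y M) ([/]-relabel x y N)

[/]-self : ∀ {n} x (M : Term n) → M [ free x / x ] ≡ M
[/]-self x M = ≡-trans ([/]-relabel x x M) (relabel-id-local M λ {z} _ → ↤-self x z)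

relabel-[/] : ∀ {n ρ} → Injective _≡_ _≡_ ρ → ∀ x y (M : Term n) →
              relabel ρ (M [ free y / x ]) ≡ relabel ρ M [ free (ρ y) / ρ x ]
relabel-[/] {ρ = ρ} inj x y M = begin
  relabel ρ (M [ free y / x ])           ≡⟨ cong (relabel ρ) ([/]-relabel x y M) ⟩
  relabel ρ (relabel (y ↤ x) M)          ≡⟨ relabel-∘ ρ (y ↤ x) M ⟩
  relabel (ρ ∘ (y ↤ x)) M                ≡⟨ relabel-cong M commutes ⟩
  relabel ((ρ y ↤ ρ x) ∘ ρ) M            ≡⟨ relabel-∘ (ρ y ↤ ρ x) ρ M ⟨
  relabel (ρ y ↤ ρ x) (relabel ρ M)      ≡⟨ [/]-relabel (ρ x) (ρ y) (relabel ρ M) ⟨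
  relabel ρ M [ free (ρ y) / ρ x ]       ∎
  where
  open ≡-Reasoning
  commutes : ∀ z → ρ ((y ↤ x) z) ≡ (ρ y ↤ ρ x) (ρ z)
  commutes z with x ≟ z
  ... | yes refl = sym (↤-hit (ρ y) (ρ x))
  ... | no x≢z   = sym (↤-miss (ρ y) (x≢z ∘ inj))

-- Environments

-- Renaming and type substitution are combined so that stability of derivations under both is a
-- single induction; `g` is instantiated to `S $₁_` or `id`.
act : (Name → Name) → (T₁ → T₁) → Env → Env
act ρ g = map λ (x , τ⃗) → ρ x , g τ⃗

dom-act : ∀ ρ g Γ → dom (act ρ g Γ) ≡ map ρ (dom Γ)
dom-act ρ g []      = refl
dom-act ρ g (d ∷ Γ) = cong (ρ (proj₁ d) ∷_) (dom-act ρ g Γ)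

consistent-act : ∀ {ρ} g → Injective _≡_ _≡_ ρ → ∀ Γ → Consistent Γ → Consistent (act ρ g Γ)
consistent-act {ρ} g inj Γ c = subst Unique (sym (dom-act ρ g Γ)) (Unique.map⁺ inj c)

dom-++ : ∀ Γ Δ → dom (Γ ++ Δ) ≡ dom Γ ++ dom Δ
dom-++ Γ Δ = map-++ proj₁ Γ Δ

consistent-↭ : ∀ {Γ Δ} → Γ ↭ Δ → Consistent Γ → Consistent Δ
consistent-↭ p = Unique-resp-↭ (setoid Name) (↭⇒↭ₛ (↭-map⁺ proj₁ p))

consistent-mid : ∀ Γ {d Δ} → Consistent (Γ ++ d ∷ Δ) → Consistent (d ∷ Γ ++ Δ)
consistent-mid Γ {d} {Δ} = consistent-↭ (shift d Γ Δ)

∉-dom-mid : ∀ Γ {x τ⃗ Δ} → Consistent (Γ ++ (x ∶ τ⃗) ∷ Δ) → x ∉ dom Γ × x ∉ dom Δ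
∉-dom-mid Γ {x} {Δ = Δ} c with Unique.Unique[x∷xs]⇒x∉xs (consistent-mid Γ c)
... | x∉ = (λ x∈ → x∉ (subst (x ∈_) (sym (dom-++ Γ Δ)) (∈-++⁺ˡ x∈)))
         , (λ x∈ → x∉ (subst (x ∈_) (sym (dom-++ Γ Δ)) (∈-++⁺ʳ (dom Γ) x∈)))

∉-dom⇒All : ∀ {x} Γ → x ∉ dom Γ → All (λ d → x ≢ proj₁ d) Γ
∉-dom⇒All []      x∉ = []
∉-dom⇒All (d ∷ Γ) x∉ = (λ eq → x∉ (here eq)) ∷ ∉-dom⇒All Γ (x∉ ∘ there)

∈-dom⇒∃++ : ∀ {x} Γ → x ∈ dom Γ → ∃[ A ] ∃[ τ⃗ ] ∃[ B ] Γ ≡ A ++ (x ∶ τ⃗) ∷ B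
∈-dom⇒∃++ Γ x∈ with ∈-map⁻ proj₁ x∈
... | (_ , τ⃗) , d∈ , refl with ∈-∃++ d∈
...   | A , B , eq = A , τ⃗ , B , eq

lookup-∉ : ∀ {x} Γ → x ∉ dom Γ → lookup Γ x ≡ nothing
lookup-∉ []            x∉ = refl
lookup-∉ {x} ((y ∶ τ⃗) ∷ Γ) x∉ with x ≟ y
... | yes refl = contradiction (here refl) x∉
... | no _     = lookup-∉ Γ (x∉ ∘ there)

lookup-here : ∀ x {τ⃗} Γ → lookup ((x ∶ τ⃗) ∷ Γ) x ≡ just τ⃗
lookup-here x Γ with x ≟ x
... | yes _  = refl
... | no x≢x = contradiction refl x≢x

lookup-there : ∀ {x y τ⃗} Γ → x ≢ y → lookup ((y ∶ τ⃗) ∷ Γ) x ≡ lookup Γ x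
lookup-there {x} {y} Γ x≢y with x ≟ y
... | yes x≡y = contradiction x≡y x≢y
... | no _    = refl

lookup-act : ∀ {ρ} g → Injective _≡_ _≡_ ρ → ∀ Γ x →
             lookup (act ρ g Γ) (ρ x) ≡ Maybe.map g (lookup Γ x)
lookup-act g inj [] x = refl
lookup-act {ρ} g inj ((y ∶ τ⃗) ∷ Γ) x with x ≟ y | ρ x ≟ ρ y
... | yes _   | yes _     = refl
... | yes x≡y | no ρx≢ρy  = contradiction (cong ρ x≡y) ρx≢ρy
... | no x≢y  | yes ρx≡ρy = contradiction (inj ρx≡ρy) x≢y
... | no _    | no _      = lookup-act g inj Γ x

-- Γ₁ ⊕ Γ₂ is absorb Γ₂ Γ₁ ++ fresh (dom Γ₁) Γ₂ by definition.
absorb₁ : Env → Decl → Decl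
absorb₁ Δ (x , τ⃗) = x , maybe′ (τ⃗ ⁺++⁺_) τ⃗ (lookup Δ x)

absorb : Env → Env → Env
absorb Δ = map (absorb₁ Δ)

fresh : List Name → Env → Env
fresh xs = filter λ d → proj₁ d ∉? xs

dom-absorb : ∀ Δ Γ → dom (absorb Δ Γ) ≡ dom Γ
dom-absorb Δ Γ = sym (map-∘ Γ)

dom-fresh⁻ : ∀ {xs} Δ {y} → y ∈ dom (fresh xs Δ) → y ∉ xs
dom-fresh⁻ {xs} Δ y∈ with ∈-map⁻ proj₁ y∈
... | d , d∈ , refl = proj₂ (∈-filter⁻ (λ d → proj₁ d ∉? xs) {xs = Δ} d∈)

consistent-⊕ : ∀ Γ Δ → Consistent Γ → Consistent Δ → Consistent (Γ ⊕ Δ)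
consistent-⊕ Γ Δ c d = subst Unique (sym dom-⊕)
  (Unique.++⁺ c (AllPairs.map⁺ (AllPairs.filter⁺ _ (AllPairs.map⁻ d)))
    λ (y∈Γ , y∈Δ) → dom-fresh⁻ Δ y∈Δ y∈Γ)
  where
  dom-⊕ : dom (Γ ⊕ Δ) ≡ dom Γ ++ dom (fresh (dom Γ) Δ)
  dom-⊕ = ≡-trans (dom-++ (absorb Δ Γ) _) (cong (_++ dom (fresh (dom Γ) Δ)) (dom-absorb Δ Γ))

fresh-act : ∀ {ρ} g → Injective _≡_ _≡_ ρ → ∀ xs Δ →
            act ρ g (fresh xs Δ) ≡ fresh (map ρ xs) (act ρ g Δ)
fresh-act g inj xs [] = refl
fresh-act {ρ} g inj xs ((y ∶ τ⃗) ∷ Δ) with y ∈? xs | ρ y ∈? map ρ xs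
... | yes y∈ | yes _   = fresh-act g inj xs Δ
... | yes y∈ | no ρy∉  = contradiction (∈-map⁺ ρ y∈) ρy∉
... | no y∉  | no _    = cong (_ ∷_) (fresh-act g inj xs Δ)
... | no y∉  | yes ρy∈ with ∈-map⁻ ρ ρy∈
...   | z , z∈ , ρy≡ρz = contradiction (subst (_∈ xs) (sym (inj ρy≡ρz)) z∈) y∉

module _ {ρ : Name → Name} {g : T₁ → T₁}
         (inj : Injective _≡_ _≡_ ρ) (hom : ∀ τ⃗ τ⃗′ → g (τ⃗ ⁺++⁺ τ⃗′) ≡ g τ⃗ ⁺++⁺ g τ⃗′) where

  -- An injective `ρ` neither creates nor destroys coincidences between the two domains, and `hom`
  -- covers the sequences that are joined at a shared variable.
  act-⊕ : ∀ Γ Δ → act ρ g (Γ ⊕ Δ) ≡ act ρ g Γ ⊕ act ρ g Δ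
  act-⊕ Γ Δ = ≡-trans (map-++ _ (absorb Δ Γ) (fresh (dom Γ) Δ))
    (cong₂ _++_ act-absorb
      (≡-trans (fresh-act g inj (dom Γ) Δ)
               (cong (λ xs → fresh xs (act ρ g Δ)) (sym (dom-act ρ g Γ)))))
    where
    act-absorb₁ : ∀ x τ⃗ → g (proj₂ (absorb₁ Δ (x , τ⃗))) ≡
                          proj₂ (absorb₁ (act ρ g Δ) (ρ x , g τ⃗))
    act-absorb₁ x τ⃗ rewrite lookup-act g inj Δ x with lookup Δ x
    ... | just τ⃗′ = hom τ⃗ τ⃗′
    ... | nothing  = refl

    act-absorb : act ρ g (absorb Δ Γ) ≡ absorb (act ρ g Δ) (act ρ g Γ)
    act-absorb = ≡-trans (sym (map-∘ Γ))
      (≡-trans (map-cong (λ (x , τ⃗) → cong (ρ x ,_) (act-absorb₁ x τ⃗)) Γ) (map-∘ Γ))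

  act-⨁ : ∀ Γs → act ρ g (⨁ Γs) ≡ ⨁ (map (act ρ g) Γs)
  act-⨁ []       = refl
  act-⨁ (Γ ∷ Γs) = ≡-trans (act-⊕ Γ (⨁ Γs)) (cong (act ρ g Γ ⊕_) (act-⨁ Γs))

absorb-∉ : ∀ {y τ⃗} Δ Γ → y ∉ dom Γ → absorb ((y ∶ τ⃗) ∷ Δ) Γ ≡ absorb Δ Γ
absorb-∉ Δ Γ y∉ = map-cong-local
  (All.map (λ {(x , τ⃗)} y≢x → cong (λ m → x , maybe′ (τ⃗ ⁺++⁺_) τ⃗ m) (lookup-there Δ (y≢x ∘ sym)))
           (∉-dom⇒All Γ y∉))

fresh-snoc : ∀ {y} xs Δ → y ∉ dom Δ → fresh (xs ++ y ∷ []) Δ ≡ fresh xs Δ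
fresh-snoc xs [] y∉ = refl
fresh-snoc {y} xs ((z ∶ τ⃗) ∷ Δ) y∉ with z ∈? xs | z ∈? (xs ++ y ∷ [])
... | yes _  | yes _  = fresh-snoc xs Δ (y∉ ∘ there)
... | no _   | no _   = cong (_ ∷_) (fresh-snoc xs Δ (y∉ ∘ there))
... | yes z∈ | no z∉  = contradiction (∈-++⁺ˡ z∈) z∉
... | no z∉  | yes z∈ with ∈-++⁻ xs z∈
...   | inj₁ z∈xs        = contradiction z∈xs z∉
...   | inj₂ (here refl) = contradiction (here refl) y∉

⊕-identityʳ : ∀ Γ → Γ ⊕ [] ≡ Γ
⊕-identityʳ Γ = ≡-trans (++-identityʳ _) (map-id Γ)

-- Together with `⊕-merge` this computes a sum by moving the declarations of the right operand
-- across one at a time: a new variable goes to the end, a shared one joins its partner in place.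
-- `⊢-merge` follows the same recursion.
⊕-snoc : ∀ {y τ⃗} Γ Δ → y ∉ dom Γ → y ∉ dom Δ →
         (Γ ++ (y ∶ τ⃗) ∷ []) ⊕ Δ ≡ Γ ⊕ ((y ∶ τ⃗) ∷ Δ)
⊕-snoc {y} {τ⃗} Γ Δ y∉Γ y∉Δ = begin
  absorb Δ (Γ ++ d ∷ []) ++ fresh (dom (Γ ++ d ∷ [])) Δ
    ≡⟨ cong₂ _++_ (map-++ (absorb₁ Δ) Γ _)
         (≡-trans (cong (λ xs → fresh xs Δ) (dom-++ Γ (d ∷ []))) (fresh-snoc (dom Γ) Δ y∉Δ)) ⟩
  (absorb Δ Γ ++ absorb₁ Δ d ∷ []) ++ fresh (dom Γ) Δ
    ≡⟨ ++-assoc (absorb Δ Γ) _ _ ⟩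
  absorb Δ Γ ++ absorb₁ Δ d ∷ fresh (dom Γ) Δ
    ≡⟨ cong₂ (λ xs m → xs ++ (y , maybe′ (τ⃗ ⁺++⁺_) τ⃗ m) ∷ fresh (dom Γ) Δ)
         (sym (absorb-∉ Δ Γ y∉Γ)) (lookup-∉ Δ y∉Δ) ⟩
  absorb (d ∷ Δ) Γ ++ d ∷ fresh (dom Γ) Δ
    ≡⟨ cong (absorb (d ∷ Δ) Γ ++_) (filter-accept (λ d → proj₁ d ∉? dom Γ) y∉Γ) ⟨
  Γ ⊕ (d ∷ Δ) ∎
  where
  open ≡-Reasoning
  d : Decl
  d = y ∶ τ⃗

⊕-merge : ∀ {y τ⃗₁ τ⃗₂} A B Δ → y ∉ dom A → y ∉ dom B → y ∉ dom Δ →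
          (A ++ (y ∶ τ⃗₁ ⁺++⁺ τ⃗₂) ∷ B) ⊕ Δ ≡ (A ++ (y ∶ τ⃗₁) ∷ B) ⊕ ((y ∶ τ⃗₂) ∷ Δ)
⊕-merge {y} {τ⃗₁} {τ⃗₂} A B Δ y∉A y∉B y∉Δ = cong₂ _++_ absorb≡ fresh≡
  where
  open ≡-Reasoning
  d : Decl
  d = y ∶ τ⃗₂
  absorb≡ : absorb Δ (A ++ (y ∶ τ⃗₁ ⁺++⁺ τ⃗₂) ∷ B) ≡ absorb (d ∷ Δ) (A ++ (y ∶ τ⃗₁) ∷ B)
  absorb≡ = begin
    absorb Δ (A ++ (y ∶ τ⃗₁ ⁺++⁺ τ⃗₂) ∷ B)
      ≡⟨ map-++ (absorb₁ Δ) A _ ⟩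
    absorb Δ A ++ absorb₁ Δ (y ∶ τ⃗₁ ⁺++⁺ τ⃗₂) ∷ absorb Δ B
      ≡⟨ cong (λ m → absorb Δ A ++ (y , maybe′ ((τ⃗₁ ⁺++⁺ τ⃗₂) ⁺++⁺_) (τ⃗₁ ⁺++⁺ τ⃗₂) m) ∷ absorb Δ B)
           (lookup-∉ Δ y∉Δ) ⟩
    absorb Δ A ++ (y ∶ τ⃗₁ ⁺++⁺ τ⃗₂) ∷ absorb Δ B
      ≡⟨ cong (λ m → absorb Δ A ++ (y , maybe′ (τ⃗₁ ⁺++⁺_) τ⃗₁ m) ∷ absorb Δ B) (lookup-here y Δ) ⟨
    absorb Δ A ++ absorb₁ (d ∷ Δ) (y ∶ τ⃗₁) ∷ absorb Δ B
      ≡⟨ cong₂ (λ A′ B′ → A′ ++ absorb₁ (d ∷ Δ) (y ∶ τ⃗₁) ∷ B′) (absorb-∉ Δ A y∉A) (absorb-∉ Δ B y∉B) ⟨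
    absorb (d ∷ Δ) A ++ absorb₁ (d ∷ Δ) (y ∶ τ⃗₁) ∷ absorb (d ∷ Δ) B
      ≡⟨ map-++ (absorb₁ (d ∷ Δ)) A _ ⟨
    absorb (d ∷ Δ) (A ++ (y ∶ τ⃗₁) ∷ B) ∎
  y∈ : y ∈ dom (A ++ (y ∶ τ⃗₁) ∷ B)
  y∈ = subst (y ∈_) (sym (dom-++ A _)) (∈-++⁺ʳ (dom A) (here refl))
  fresh≡ : fresh (dom (A ++ (y ∶ τ⃗₁ ⁺++⁺ τ⃗₂) ∷ B)) Δ ≡ fresh (dom (A ++ (y ∶ τ⃗₁) ∷ B)) (d ∷ Δ)
  fresh≡ = begin
    fresh (dom (A ++ (y ∶ τ⃗₁ ⁺++⁺ τ⃗₂) ∷ B)) Δ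
      ≡⟨ cong (λ xs → fresh xs Δ) (≡-trans (dom-++ A _) (sym (dom-++ A _))) ⟩
    fresh (dom (A ++ (y ∶ τ⃗₁) ∷ B)) Δ
      ≡⟨ filter-reject (λ d → proj₁ d ∉? dom (A ++ (y ∶ τ⃗₁) ∷ B)) (λ y∉ → y∉ y∈) ⟨
    fresh (dom (A ++ (y ∶ τ⃗₁) ∷ B)) (d ∷ Δ) ∎

∖-mid : ∀ A {x τ⃗} B → x ∉ dom A → x ∉ dom B → (A ++ (x ∶ τ⃗) ∷ B) ∖ x ≡ A ++ B
∖-mid A {x} {τ⃗} B x∉A x∉B = begin
  (A ++ (x ∶ τ⃗) ∷ B) ∖ x      ≡⟨ filter-++ x≢? A _ ⟩
  A ∖ x ++ ((x ∶ τ⃗) ∷ B) ∖ x  ≡⟨ cong (A ∖ x ++_) (filter-reject x≢? {xs = B} (λ x≢x → x≢x refl)) ⟩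
  A ∖ x ++ B ∖ x              ≡⟨ cong₂ _++_ (filter-all x≢? (∉-dom⇒All A x∉A))
                                         (filter-all x≢? (∉-dom⇒All B x∉B)) ⟩
  A ++ B                      ∎
  where
  open ≡-Reasoning
  x≢? : (d : Decl) → Dec (x ≢ proj₁ d)
  x≢? d = ¬? (x ≟ proj₁ d)

-- `_∖_` filters out every declaration of `x`; consistency ensures that only the given one is lost.
∈⇒↭-∖ : ∀ {x τ⃗} Γ → Consistent Γ → (x ∶ τ⃗) ∈ Γ → Γ ↭ Γ ∖ x ++ (x ∶ τ⃗) ∷ []
∈⇒↭-∖ {x} {τ⃗} Γ c x∈ with ∈-∃++ x∈
... | A , B , refl with ∉-dom-mid A c
...   | x∉A , x∉B = subst (λ Δ → A ++ (x ∶ τ⃗) ∷ B ↭ Δ ++ (x ∶ τ⃗) ∷ [])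
  (sym (∖-mid A B x∉A x∉B)) (↭-trans (shift _ A B) (∷↭∷ʳ _ (A ++ B)))

dom-≈ₑ : ∀ {Γ Δ} → Γ ≈ₑ Δ → dom Γ ≡ dom Δ
dom-≈ₑ []                 = refl
dom-≈ₑ ((x≡y , _) ∷ Γ≈Δ) = cong₂ _∷_ x≡y (dom-≈ₑ Γ≈Δ)

-- Type substitutions

$₂-⌊⌋ : ∀ S τ → S $₂ ⌊ τ ⌋ ≡ ⌊ S $₀ τ ⌋
$₂-⌊⌋ S (tv α)    = refl
$₂-⌊⌋ S (τ₁ ⊸ τ₂) = cong (S $₀ τ₁ ⊸_) ($₂-⌊⌋ S τ₂)

$₀-[] : ∀ τ → [] $₀ τ ≡ τ
$₀-[] (tv α)    = refl
$₀-[] (τ₁ ⊸ τ₂) = cong₂ _⊸_ ($₀-[] τ₁) ($₀-[] τ₂)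

$₁-[] : ∀ τ⃗ → [] $₁ τ⃗ ≡ τ⃗
$₁-[] (τ ∷ τs) = cong₂ _∷_ ($₀-[] τ) (≡-trans (map-cong $₀-[] τs) (map-id τs))

$₂-[] : ∀ σ → [] $₂ σ ≡ σ
$₂-[] (tv α)       = refl
$₂-[] (τ ⊸ σ)      = cong₂ _⊸_ ($₀-[] τ) ($₂-[] σ)
$₂-[] (τ ∩ τ⃗ ⟶ σ)
  rewrite $₀-[] τ | $₁-[] τ⃗ | $₂-[] σ = refl

≈₂-⌊⌋ : ∀ τ → ⌊ τ ⌋ ≈₂ ⌊ τ ⌋
≈₂-⌊⌋ (tv α)    = tv
≈₂-⌊⌋ (τ₁ ⊸ τ₂) = τ₁ ⊸ ≈₂-⌊⌋ τ₂

$₂-≈ : ∀ S {σ σ′} → σ ≈₂ σ′ → S $₂ σ ≈₂ S $₂ σ′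
$₂-≈ S (tv {α})   = ≈₂-⌊⌋ (S $ᵥ α)
$₂-≈ S (τ ⊸ σ≈)   = (S $₀ τ) ⊸ $₂-≈ S σ≈
$₂-≈ S (τ⃗≈ ∩⟶ σ≈) = ↭-map⁺ (S $₀_) τ⃗≈ ∩⟶ $₂-≈ S σ≈

act-≈ : ∀ ρ S {Γ Δ} → Γ ≈ₑ Δ → act ρ (S $₁_) Γ ≈ₑ act ρ (S $₁_) Δ
act-≈ ρ S []                  = []
act-≈ ρ S ((x≡y , τ⃗≈) ∷ Γ≈Δ) = (cong ρ x≡y , ↭-map⁺ (S $₀_) τ⃗≈) ∷ act-≈ ρ S Γ≈Δ

-- Derivations

⊢-cast : ∀ {Γ Γ′ M M′ σ σ′} → Γ ≡ Γ′ → M ≡ M′ → σ ≡ σ′ → Γ ⊢₂ M ∶ σ → Γ′ ⊢₂ M′ ∶ σ′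
⊢-cast refl refl refl D = D

⊢-consistent : ∀ {Γ M σ} → Γ ⊢₂ M ∶ σ → Consistent Γ
⊢-consistent axiom = [] ∷ []
⊢-consistent (exchange {Γ₁} D) = consistent-↭ (++⁺ˡ Γ₁ (swap _ _ refl)) (⊢-consistent D)
⊢-consistent (contraction D c) = c
⊢-consistent (→-intro {Γ} D) =
  subst Consistent (++-identityʳ Γ) (AllPairs.tail (consistent-mid Γ (⊢-consistent D)))
⊢-consistent (→-elim D Ds c) = c
⊢-consistent (⊸-intro {Γ} D) =
  subst Consistent (++-identityʳ Γ) (AllPairs.tail (consistent-mid Γ (⊢-consistent D)))
⊢-consistent (⊸-elim D E c) = c
⊢-consistent (types-mod-≈ Γ≈ σ≈ D) = subst Unique (dom-≈ₑ Γ≈) (⊢-consistent D)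

-- The prefix `Θ` makes the induction go through: `prep` and `swap` keep the tail to be permuted
-- behind a head, which is moved into `Θ`, and `exchange` acts at any depth.
⊢-↭-suffix : ∀ Θ {Γ Δ M σ} → Γ ↭ Δ → Θ ++ Γ ⊢₂ M ∶ σ → Θ ++ Δ ⊢₂ M ∶ σ
⊢-↭-suffix Θ refl D = D
⊢-↭-suffix Θ (prep {xs = Γ} {ys = Δ} d p) D =
  ⊢-cast (++-assoc Θ (d ∷ []) Δ) refl refl
    (⊢-↭-suffix (Θ ++ d ∷ []) p (⊢-cast (sym (++-assoc Θ (d ∷ []) Γ)) refl refl D))
⊢-↭-suffix Θ (swap {xs = Γ} {ys = Δ} d e p) D =
  ⊢-cast (++-assoc Θ (e ∷ d ∷ []) Δ) refl refl
    (⊢-↭-suffix (Θ ++ e ∷ d ∷ []) p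
      (⊢-cast (sym (++-assoc Θ (e ∷ d ∷ []) Γ)) refl refl (exchange {Γ₁ = Θ} D)))
⊢-↭-suffix Θ (trans p q) D = ⊢-↭-suffix Θ q (⊢-↭-suffix Θ p D)

⊢-↭ : ∀ {Γ Δ M σ} → Γ ↭ Δ → Γ ⊢₂ M ∶ σ → Δ ⊢₂ M ∶ σ
⊢-↭ = ⊢-↭-suffix []

module _ {ρ : Name → Name} (inj : Injective _≡_ _≡_ ρ) (S : TSubst) where

  private
    h : Env → Env
    h = act ρ (S $₁_)

    h-++ : ∀ Γ Δ → h (Γ ++ Δ) ≡ h Γ ++ h Δ
    h-++ = map-++ _

  -- Injectivity of `ρ` enters in four places: consistency of the conclusions, sums of environments,
  -- abstraction, and the substitutions of contraction.
  ⊢-act  : ∀ {Γ M σ} → Γ ⊢₂ M ∶ σ → h Γ ⊢₂ relabel ρ M ∶ S $₂ σ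
  ⊢-acts : ∀ {Γs M τs} → Pointwise (λ Γ τ → Γ ⊢₂ M ∶ ⌊ τ ⌋) Γs τs →
           Pointwise (λ Γ τ → Γ ⊢₂ relabel ρ M ∶ ⌊ τ ⌋) (map h Γs) (map (S $₀_) τs)

  ⊢-act (axiom {x} {τ}) = ⊢-cast refl refl (sym ($₂-⌊⌋ S τ)) axiom
  ⊢-act (exchange {Γ₁} D) =
    ⊢-cast (sym (h-++ Γ₁ _)) refl refl
      (exchange {Γ₁ = h Γ₁} (⊢-cast (h-++ Γ₁ _) refl refl (⊢-act D)))
  ⊢-act (contraction {Γ₁} {Γ₂} {x₁} {x₂} {x} {τ⃗₁} {τ⃗₂} {M} D c) =
    ⊢-cast (sym h-contracted) (sym relabelled) refl
      (contraction {Γ₁ = h Γ₁} (⊢-cast (h-++ Γ₁ _) refl refl (⊢-act D))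
        (subst Consistent h-contracted (consistent-act (S $₁_) inj _ c)))
    where
    h-contracted : h (Γ₁ ++ (x ∶ τ⃗₁ ⁺++⁺ τ⃗₂) ∷ Γ₂) ≡
                   h Γ₁ ++ (ρ x ∶ (S $₁ τ⃗₁) ⁺++⁺ (S $₁ τ⃗₂)) ∷ h Γ₂
    h-contracted = ≡-trans (h-++ Γ₁ _)
      (cong (λ τ⃗ → h Γ₁ ++ (ρ x ∶ τ⃗) ∷ h Γ₂) (map-⁺++⁺ (S $₀_) τ⃗₁ τ⃗₂))
    relabelled : relabel ρ (M [ free x / x₁ ] [ free x / x₂ ]) ≡
                 relabel ρ M [ free (ρ x) / ρ x₁ ] [ free (ρ x) / ρ x₂ ]
    relabelled = ≡-trans (relabel-[/] inj x₂ x (M [ free x / x₁ ]))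
      (cong _[ free (ρ x) / ρ x₂ ] (relabel-[/] inj x₁ x M))
  ⊢-act (→-intro {Γ} {x} {M = M} D) =
    ⊢-cast refl (cong lam (sym (relabel-close inj x M))) refl
      (→-intro (⊢-cast (h-++ Γ _) refl refl (⊢-act D)))
  ⊢-act (→-elim {Γ} {Γs} D Ds c) =
    ⊢-cast (sym h-sum) refl refl
      (→-elim (⊢-act D) (⊢-acts Ds) (subst Consistent h-sum (consistent-act (S $₁_) inj _ c)))
    where
    h-sum : h (Γ ++ ⨁ Γs) ≡ h Γ ++ ⨁ (map h Γs)
    h-sum = ≡-trans (h-++ Γ _) (cong (h Γ ++_) (act-⨁ inj (map-⁺++⁺ (S $₀_)) Γs))
  ⊢-act (⊸-intro {Γ} {x} {M = M} D) =
    ⊢-cast refl (cong lam (sym (relabel-close inj x M))) refl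
      (⊸-intro (⊢-cast (h-++ Γ _) refl refl (⊢-act D)))
  ⊢-act (⊸-elim {Γ₁} {Γ₂} {τ} D E c) =
    ⊢-cast (sym (h-++ Γ₁ Γ₂)) refl refl
      (⊸-elim (⊢-act D) (⊢-cast refl refl ($₂-⌊⌋ S τ) (⊢-act E))
        (subst Consistent (h-++ Γ₁ Γ₂) (consistent-act (S $₁_) inj _ c)))
  ⊢-act (types-mod-≈ Γ≈ σ≈ D) = types-mod-≈ (act-≈ ρ S Γ≈) ($₂-≈ S σ≈) (⊢-act D)

  ⊢-acts []       = []
  ⊢-acts {τs = τ ∷ _} (D ∷ Ds) = ⊢-cast refl refl ($₂-⌊⌋ S τ) (⊢-act D) ∷ ⊢-acts Ds

⊢-$ : ∀ S {Γ M σ} → Γ ⊢₂ M ∶ σ → S $ₑ Γ ⊢₂ M ∶ S $₂ σ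
⊢-$ S {M = M} D = ⊢-cast refl (relabel-id M) refl (⊢-act (λ eq → eq) S D)

⊢-relabel : ∀ ρ → Injective _≡_ _≡_ ρ → ∀ {Γ M σ} →
            Γ ⊢₂ M ∶ σ → act ρ id Γ ⊢₂ relabel ρ M ∶ σ
⊢-relabel ρ inj {Γ} {σ = σ} D =
  ⊢-cast (map-cong (λ (x , τ⃗) → cong (ρ x ,_) ($₁-[] τ⃗)) Γ) refl ($₂-[] σ) (⊢-act inj [] D)

$ₑ-⊕ : ∀ S Γ Δ → S $ₑ (Γ ⊕ Δ) ≡ (S $ₑ Γ) ⊕ (S $ₑ Δ)
$ₑ-⊕ S = act-⊕ (λ eq → eq) (map-⁺++⁺ (S $₀_))

-- Merging environments by contraction

-- One round of the merge: `z` is the renamed copy of `y`, and `Θ` holds the declarations still to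
-- come. A new `y` was not renamed and simply joins the left part; a shared one is contracted with
-- its copy. The equation for `⊕` shows that the remaining rounds still compute the intended sum.
⊢-merge₁ : ∀ {y z τ⃗ P σ} Γ {Θ} → z ≡ y × y ∉ dom Γ ⊎ y ∈ dom Γ →
           Γ ++ (z ∶ τ⃗) ∷ Θ ⊢₂ P ∶ σ →
           ∃[ Γ′ ] y ∈ dom Γ′ × (∀ {x} → x ∈ dom Γ → x ∈ dom Γ′)
                 × (∀ {Δ} → y ∉ dom Δ → Γ′ ⊕ Δ ≡ Γ ⊕ ((y ∶ τ⃗) ∷ Δ))
                 × Γ′ ++ Θ ⊢₂ P [ free y / z ] ∶ σ
⊢-merge₁ {y} {z} {τ⃗} {P} Γ {Θ} (inj₁ (refl , y∉)) D =
  Γ ++ (y ∶ τ⃗) ∷ []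
  , subst (y ∈_) (sym (dom-++ Γ _)) (∈-++⁺ʳ (dom Γ) (here refl))
  , (λ x∈ → subst (_ ∈_) (sym (dom-++ Γ _)) (∈-++⁺ˡ x∈))
  , (λ {Δ} y∉Δ → ⊕-snoc Γ Δ y∉ y∉Δ)
  , ⊢-cast (sym (++-assoc Γ _ Θ)) (sym ([/]-self y P)) refl D
⊢-merge₁ {y} {z} {τ⃗} {P} Γ {Θ} (inj₂ y∈) D with ∈-dom⇒∃++ Γ y∈
... | A , τ⃗₁ , B , refl with ∉-dom-mid A (subst Consistent (++-assoc A _ _) (⊢-consistent D))
...   | y∉A , y∉BΘ =
  A ++ (y ∶ τ⃗₁ ⁺++⁺ τ⃗) ∷ B
  , subst (y ∈_) dom≡ y∈
  , subst (_ ∈_) dom≡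
  , (λ {Δ} y∉Δ → ⊕-merge A B Δ y∉A y∉B y∉Δ)
  -- Contracting to the name `y` itself makes the first of the two substitutions trivial; only `y`
  -- for `z` remains.
  , ⊢-cast (sym (++-assoc A _ Θ)) (cong _[ free y / z ] ([/]-self y P)) refl
      (contraction {Γ₁ = A} {Γ₂ = B ++ Θ} {x₁ = y} {x₂ = z} {x = y} D′ (subst Unique dom′≡ c′))
  where
  y∉B : y ∉ dom B
  y∉B y∈B = y∉BΘ (subst (y ∈_) (sym (dom-++ B _)) (∈-++⁺ˡ y∈B))
  dom≡ : dom (A ++ (y ∶ τ⃗₁) ∷ B) ≡ dom (A ++ (y ∶ τ⃗₁ ⁺++⁺ τ⃗) ∷ B)
  dom≡ = ≡-trans (dom-++ A _) (sym (dom-++ A _))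
  D′ : A ++ (y ∶ τ⃗₁) ∷ (z ∶ τ⃗) ∷ B ++ Θ ⊢₂ P ∶ _
  -- Contraction joins neighbours, so the declaration of `z` is moved back across `B` to stand next
  -- to that of `y`.
  D′ = ⊢-↭-suffix A (prep _ (shift _ B Θ)) (⊢-cast (++-assoc A _ _) refl refl D)
  -- The contracted environment has the variables of `D′` except `z`, which is brought to the front
  -- and dropped.
  c′ : Consistent (A ++ (y ∶ τ⃗₁) ∷ B ++ Θ)
  c′ = AllPairs.tail (consistent-↭ (↭-trans (++⁺ˡ A (swap _ _ refl)) (shift _ A _)) (⊢-consistent D′))
  dom′≡ : dom (A ++ (y ∶ τ⃗₁) ∷ B ++ Θ) ≡ dom (A ++ (y ∶ τ⃗₁ ⁺++⁺ τ⃗) ∷ B ++ Θ)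
  dom′≡ = ≡-trans (dom-++ A _) (sym (dom-++ A _))

-- When both alternatives hold the second is chosen, as the first case of `⊢-merge₁` demands a
-- variable that is new.
disjointify : ∀ {a} {A : Set a} {x : Name} {xs} → A ⊎ x ∈ xs → A × x ∉ xs ⊎ x ∈ xs
disjointify (inj₂ x∈) = inj₂ x∈
disjointify {x = x} {xs} (inj₁ a) with x ∈? xs
... | yes x∈ = inj₂ x∈
... | no x∉  = inj₁ (a , x∉)

-- The contractions together apply a map `φ` that undoes `ρ` on `Δ`. Returning `φ` with its action
-- on names, for an arbitrary term `P`, lets function and argument be restored separately later. The
-- last clause says that a name is left alone unless it is the image of a different name of `Δ`.
⊢-merge : ∀ ρ Γ Δ {P σ} → (∀ {y} → y ∈ dom Δ → ρ y ≡ y ⊎ y ∈ dom Γ) →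
          Γ ++ act ρ id Δ ⊢₂ P ∶ σ →
          ∃[ φ ] (Γ ⊕ Δ ⊢₂ relabel φ P ∶ σ)
               × (∀ {y} → y ∈ dom Δ → φ (ρ y) ≡ y)
               × (∀ {z} → (∀ {y} → y ∈ dom Δ → ρ y ≡ z → y ≡ z) → φ z ≡ z)
⊢-merge ρ Γ [] {P} sep D =
  id , ⊢-cast (≡-trans (++-identityʳ Γ) (sym (⊕-identityʳ Γ))) (sym (relabel-id P)) refl D
  , (λ ()) , λ _ → refl
⊢-merge ρ Γ ((y ∶ τ⃗) ∷ Δ) {P} sep D with ⊢-merge₁ {y} {ρ y} Γ (disjointify (sep (here refl))) D
... | Γ′ , y∈Γ′ , Γ⊆Γ′ , ⊕≡ , D′
  with ⊢-merge ρ Γ′ Δ (λ z∈ → Sum.map₂ Γ⊆Γ′ (sep (there z∈))) D′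
...   | φ , E , φ-ρ , φ-id =
  φ ∘ (y ↤ ρ y)
  , ⊢-cast (⊕≡ y∉Δ) (≡-trans (cong (relabel φ) ([/]-relabel (ρ y) y P)) (relabel-∘ φ _ P)) refl E
  , φ′-ρ , φ′-id
  where
  -- The environment of `D` lists `ρ y` before the images of `Δ`, so its consistency keeps them
  -- distinct.
  ρΔ-fresh : ∀ {z} → z ∈ dom Δ → ρ z ≢ ρ y
  ρΔ-fresh z∈ ρz≡ρy = proj₂ (∉-dom-mid Γ (⊢-consistent D))
    (subst₂ _∈_ ρz≡ρy (sym (dom-act ρ id Δ)) (∈-map⁺ ρ z∈))
  y∉Δ : y ∉ dom Δ
  y∉Δ y∈ = ρΔ-fresh y∈ refl
  -- After this round `y` is declared in `Γ′`, beside the images still waiting. Consistency of `D′`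
  -- thus excludes `y` from them, and the later rounds cannot move it again.
  ρΔ∌y : ∀ {z} → z ∈ dom Δ → ρ z ≢ y
  ρΔ∌y z∈ ρz≡y with ∈-dom⇒∃++ Γ′ y∈Γ′
  ... | A , _ , B , refl = proj₂ (∉-dom-mid A (subst Consistent (++-assoc A _ _) (⊢-consistent D′)))
    (subst (y ∈_) (sym (dom-++ B _)) (∈-++⁺ʳ (dom B)
      (subst₂ _∈_ ρz≡y (sym (dom-act ρ id Δ)) (∈-map⁺ ρ z∈))))
  φy≡y : φ y ≡ y
  φy≡y = φ-id λ z∈ ρz≡y → contradiction ρz≡y (ρΔ∌y z∈)
  φ′-ρ : ∀ {z} → z ∈ y ∷ dom Δ → φ ((y ↤ ρ y) (ρ z)) ≡ z
  φ′-ρ (here refl) = ≡-trans (cong φ (↤-hit y (ρ y))) φy≡y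
  φ′-ρ (there z∈)  = ≡-trans (cong φ (↤-miss y (ρΔ-fresh z∈ ∘ sym))) (φ-ρ z∈)
  φ′-id : ∀ {z} → (∀ {x} → x ∈ y ∷ dom Δ → ρ x ≡ z → x ≡ z) → φ ((y ↤ ρ y) z) ≡ z
  φ′-id {z} fixed with ρ y ≟ z
  ... | yes ρy≡z = ≡-trans φy≡y (fixed (here refl) ρy≡z)
  ... | no _     = φ-id (fixed ∘ there)

-- Names shared by D₁ and D₂ are shifted beyond every name in D₁, D₂ and F.
-- The names from the bound on are shifted as well, to keep the map injective.
separation : ∀ D₁ D₂ F → ∃[ ρ ] Injective _≡_ _≡_ ρ
           × (∀ {y} → y ∈ D₂ → ρ y ∉ D₁)
           × (∀ {y} → y ∈ D₂ → ρ y ≡ y ⊎ y ∈ D₁)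
           × (∀ {y z} → z ∈ F → ρ y ≡ z → y ≡ z)
           × (∀ {z} → z ∈ F → z ∉ D₂ → ρ z ≡ z)
separation D₁ D₂ F = ρ , inj , apart , fixed⊎shared , reflects-F , fixes-F
  where
  N : ℕ
  N = suc (max 0 (D₁ ++ D₂ ++ F))

  <N : ∀ {z} → z ∈ D₁ ++ D₂ ++ F → z < N
  <N z∈ = s≤s (All.lookup (xs≤max 0 (D₁ ++ D₂ ++ F)) z∈)

  Moves : Name → Set
  Moves y = N ≤ y ⊎ (y ∈ D₁ × y ∈ D₂)

  moves? : ∀ y → Dec (Moves y)
  moves? y = (N ≤? y) ⊎-dec ((y ∈? D₁) ×-dec (y ∈? D₂))

  ρ : Name → Name
  ρ y with moves? y
  ... | yes _ = N + y
  ... | no  _ = y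

  inj : Injective _≡_ _≡_ ρ
  inj {x} {y} eq with moves? x | moves? y
  ... | yes _ | yes _    = +-cancelˡ-≡ N x y eq
  ... | no _  | no _     = eq
  ... | yes _ | no stays = contradiction (inj₁ (subst (N ≤_) eq (m≤m+n N x))) stays
  ... | no stays | yes _ = contradiction (inj₁ (subst (N ≤_) (sym eq) (m≤m+n N y))) stays

  apart : ∀ {y} → y ∈ D₂ → ρ y ∉ D₁
  apart {y} y∈D₂ ρy∈D₁ with moves? y
  ... | yes _    = <⇒≱ (<N (∈-++⁺ˡ ρy∈D₁)) (m≤m+n N y)
  ... | no stays = stays (inj₂ (ρy∈D₁ , y∈D₂))

  fixed⊎shared : ∀ {y} → y ∈ D₂ → ρ y ≡ y ⊎ y ∈ D₁
  fixed⊎shared {y} y∈D₂ with moves? y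
  ... | yes (inj₁ N≤y)        = contradiction N≤y (<⇒≱ (<N (∈-++⁺ʳ D₁ (∈-++⁺ˡ y∈D₂))))
  ... | yes (inj₂ (y∈D₁ , _)) = inj₂ y∈D₁
  ... | no _                  = inj₁ refl

  reflects-F : ∀ {y z} → z ∈ F → ρ y ≡ z → y ≡ z
  reflects-F {y} z∈ ρy≡z with moves? y
  ... | yes _ = contradiction (subst (N ≤_) ρy≡z (m≤m+n N y)) (<⇒≱ (<N (∈-++⁺ʳ D₁ (∈-++⁺ʳ D₂ z∈))))
  ... | no _  = ρy≡z

  fixes-F : ∀ {z} → z ∈ F → z ∉ D₂ → ρ z ≡ z
  fixes-F {z} z∈ z∉ with moves? z
  ... | yes (inj₁ N≤z)       = contradiction N≤z (<⇒≱ (<N (∈-++⁺ʳ D₁ (∈-++⁺ʳ D₂ z∈))))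
  ... | yes (inj₂ (_ , z∈D₂)) = contradiction z∈D₂ z∉
  ... | no _                  = refl


-- The pattern common to both elimination rules, which enter through the last hypothesis. Separating
-- also from the names of `M · N` allows the terms to be restored without showing that their free
-- names are declared.
⊢-⊕-app : ∀ {Γ Δ M N σ} → Consistent Γ → Consistent Δ →
          (∀ ρ → Injective _≡_ _≡_ ρ → Consistent (Γ ++ act ρ id Δ) →
           Γ ++ act ρ id Δ ⊢₂ M · relabel ρ N ∶ σ) →
          Γ ⊕ Δ ⊢₂ M · N ∶ σ
⊢-⊕-app {Γ} {Δ} {M} {N} c d D
  with separation (dom Γ) (dom Δ) (names (M · N))
... | ρ , inj , apart , fixed⊎shared , reflects , fixes
  with ⊢-merge ρ Γ Δ fixed⊎shared (D ρ inj consistent)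
  where
  consistent : Consistent (Γ ++ act ρ id Δ)
  consistent = subst Unique (sym (dom-++ Γ _))
    (Unique.++⁺ c (consistent-act id inj Δ d) λ (y∈Γ , y∈ρΔ) →
      case-∈-map (subst (_ ∈_) (dom-act ρ id Δ) y∈ρΔ) y∈Γ)
    where
    case-∈-map : ∀ {y} → y ∈ map ρ (dom Δ) → y ∉ dom Γ
    case-∈-map y∈ with ∈-map⁻ ρ y∈
    ... | _ , z∈ , refl = apart z∈
... | φ , E , φ-ρ , φ-id = ⊢-cast refl (cong₂ _·_ M-restored N-restored) refl E
  where
  M-restored : relabel φ M ≡ M
  -- `ρ` sends no other name to a name of `M`, so `φ` fixes all of them.
  M-restored = relabel-id-local M λ z∈ → φ-id λ _ → reflects (∈-++⁺ˡ z∈)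

  -- A name declared in `Δ` is brought back by `φ`; any other name of `N` is moved by neither map.
  restores : ∀ {z} → z ∈ names N → φ (ρ z) ≡ z
  restores {z} z∈ with z ∈? dom Δ
  ... | yes z∈Δ = φ-ρ z∈Δ
  ... | no z∉Δ  = ≡-trans (cong φ (fixes z∈′ z∉Δ)) (φ-id λ _ → reflects z∈′)
    where
    z∈′ : z ∈ names (M · N)
    z∈′ = ∈-++⁺ʳ (names M) z∈

  N-restored : relabel φ (relabel ρ N) ≡ N
  N-restored = ≡-trans (relabel-∘ φ ρ N) (relabel-id-local N restores)

-- Unification

Unifies : TSubst → Equation → Set
Unifies S (τ₁ ≐ τ₂) = S $₀ τ₁ ≡ S $₀ τ₂

∪-unifies : ∀ {S R e P} → R ≋ e ∪ P → Unifies S e → All (Unifies S) P → All (Unifies S) R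
∪-unifies (R≈ , _) u us = All.tabulate λ e∈ → All.lookup (u ∷ us) (Equivalence.to R≈ e∈)

-- A solution of `tv α ≐ τ` does not distinguish `α` from `τ`, so it absorbs the replacement of one
-- by the other.
$₀-elim : ∀ S {α τ} → S $ᵥ α ≡ S $₀ τ → ∀ τ′ → S $₀ ((α , τ) ∷ []) $₀ τ′ ≡ S $₀ τ′
$₀-elim S {α} Sα≡ (tv β) with α ≟ β
... | yes refl = sym Sα≡
... | no _     = refl
$₀-elim S Sα≡ (τ₁ ⊸ τ₂) = cong₂ _⊸_ ($₀-elim S Sα≡ τ₁) ($₀-elim S Sα≡ τ₂)

substProblem-unifies : ∀ S {α τ} → S $ᵥ α ≡ S $₀ τ → ∀ P →
                       All (Unifies S) (substProblem τ α P) → All (Unifies S) P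
substProblem-unifies S Sα≡ []              []       = []
substProblem-unifies S Sα≡ ((τ₁ ≐ τ₂) ∷ P) (u ∷ us) =
  ≡-trans (sym ($₀-elim S Sα≡ τ₁)) (≡-trans u ($₀-elim S Sα≡ τ₂)) ∷ substProblem-unifies S Sα≡ P us

-- Read backwards, each rule preserves unifiers; the unifier evident from the solved form is thus
-- carried back to the original problem.
⇒-unifies : ∀ {S R P} → just R ⇒ just P → All (Unifies S) P → All (Unifies S) R
⇒-unifies (delete R≈) us              = ∪-unifies R≈ refl us
⇒-unifies (decompose R≈) (u ∷ v ∷ us) = ∪-unifies R≈ (cong₂ _⊸_ u v) us
⇒-unifies (orient R≈) (u ∷ us)        = ∪-unifies R≈ (sym u) us
-- The equation `tv α ≐ τ` stays in the problem, and its solution `u` is what undoes the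
-- substitution in the rest.
⇒-unifies {S} (eliminate {P = P} R≈ _ _) (u ∷ us) =
  ∪-unifies R≈ u (substProblem-unifies S u P us)

⇒*-unifies : ∀ {S R P} → Star _⇒_ (just R) (just P) → All (Unifies S) P → All (Unifies S) R
⇒*-unifies ε us = us
⇒*-unifies (_◅_ {j = just _} r rs) us = ⇒-unifies r (⇒*-unifies rs us)
-- No rule leaves `FAIL`, so a run that ends in a problem never passes through it.
⇒*-unifies (_◅_ {j = FAIL} _ (() ◅ _)) us

$ᵥ-∈ : ∀ {S α τ} → Unique (map proj₁ S) → (α , τ) ∈ S → S $ᵥ α ≡ τ
$ᵥ-∈ {(α , _) ∷ _} _ (here refl) with α ≟ α
... | yes _  = refl
... | no α≢α = contradiction refl α≢α
$ᵥ-∈ {(β , _) ∷ _} {α} (β≢ ∷ u) (there α∈) with β ≟ α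
... | yes β≡α = contradiction β≡α (All.lookup β≢ (∈-map⁺ proj₁ α∈))
... | no _    = $ᵥ-∈ u α∈

$ᵥ-∉ : ∀ S {α} → α ∉ map proj₁ S → S $ᵥ α ≡ tv α
$ᵥ-∉ []            α∉ = refl
$ᵥ-∉ ((β , _) ∷ S) {α} α∉ with β ≟ α
... | yes refl = contradiction (here refl) α∉
... | no _     = $ᵥ-∉ S (α∉ ∘ there)

$₀-fresh : ∀ S τ → (∀ {α} → α ∈ map proj₁ S → ¬ (α OccursIn τ)) → S $₀ τ ≡ τ
$₀-fresh S (tv α)    fr = $ᵥ-∉ S λ α∈ → fr α∈ here
$₀-fresh S (τ₁ ⊸ τ₂) fr =
  cong₂ _⊸_ ($₀-fresh S τ₁ λ α∈ → fr α∈ ∘ left) ($₀-fresh S τ₂ λ α∈ → fr α∈ ∘ right)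

-- Distinct left-hand variables make `S` send each one to its own right-hand side, and `S` fixes
-- that side because no solved variable occurs in it.
solved-unifies : ∀ S → Solved S → All (Unifies S) (equations S)
solved-unifies S (unique , apart) = All.tabulate go
  where
  go : ∀ {e} → e ∈ equations S → Unifies S e
  go e∈ with ∈-map⁻ _ e∈
  ... | (α , τ) , ατ∈ , refl = ≡-trans ($ᵥ-∈ unique ατ∈)
    (sym ($₀-fresh S τ λ β∈ → apart β∈ (∈-map⁺ proj₂ ατ∈)))

UNIFY-unifies : ∀ {P S} → UNIFY P ↦ S → All (Unifies S) P
UNIFY-unifies {S = S} (Q , steps , Q≈ , solved) =
  ⇒*-unifies steps (All.tabulate λ e∈ → All.lookup (solved-unifies S solved) (Equivalence.to Q≈ e∈))

-- Soundness

⊢-∖ : ∀ {x τ⃗ Γ M σ} → (x ∶ τ⃗) ∈ Γ → Γ ⊢₂ M ∶ σ → Γ ∖ x ++ (x ∶ τ⃗) ∷ [] ⊢₂ M ∶ σ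
⊢-∖ {Γ = Γ} x∈ D = ⊢-↭ (∈⇒↭-∖ Γ (⊢-consistent D) x∈) D

⊢-⊸-elim-⊕ : ∀ {Γ Δ M N τ σ} → Γ ⊢₂ M ∶ τ ⊸ σ → Δ ⊢₂ N ∶ ⌊ τ ⌋ → Γ ⊕ Δ ⊢₂ M · N ∶ σ
⊢-⊸-elim-⊕ {τ = τ} D E = ⊢-⊕-app (⊢-consistent D) (⊢-consistent E) λ ρ inj c →
  ⊸-elim D (⊢-relabel ρ inj E) c

-- `→-elim` already adds the environments of the argument with `⊕`, so only their sum has to be
-- moved away from `Γ`. One renaming serves all the derivations, as they must type the same renamed
-- argument.
⊢-→-elim-⊕ : ∀ {Γ Γs M N τ τ⃗ σ} → Γ ⊢₂ M ∶ τ ∩ τ⃗ ⟶ σ →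
             Pointwise (λ Γᵢ τᵢ → Γᵢ ⊢₂ N ∶ ⌊ τᵢ ⌋) Γs (toList (τ ∷⁺ τ⃗)) →
             Γ ⊕ ⨁ Γs ⊢₂ M · N ∶ σ
⊢-→-elim-⊕ {Γ} {Γs} {M} {N} {σ = σ} D Es = ⊢-⊕-app (⊢-consistent D) (consistent-⨁ Es) λ ρ inj c →
  let eq = act-⨁ inj (λ _ _ → refl) Γs in
  ⊢-cast (cong (Γ ++_) (sym eq)) refl refl
    (→-elim D (relabels ρ inj Es) (subst (λ Δ → Consistent (Γ ++ Δ)) eq c))
  where
  consistent-⨁ : ∀ {Γs τs} → Pointwise (λ Γᵢ τᵢ → Γᵢ ⊢₂ N ∶ ⌊ τᵢ ⌋) Γs τs → Consistent (⨁ Γs)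
  consistent-⨁ []       = []
  consistent-⨁ (E ∷ Es) = consistent-⊕ _ _ (⊢-consistent E) (consistent-⨁ Es)

  relabels : ∀ ρ → Injective _≡_ _≡_ ρ → ∀ {Γs τs} →
             Pointwise (λ Γᵢ τᵢ → Γᵢ ⊢₂ N ∶ ⌊ τᵢ ⌋) Γs τs →
             Pointwise (λ Γᵢ τᵢ → Γᵢ ⊢₂ relabel ρ N ∶ ⌊ τᵢ ⌋) (map (act ρ id) Γs) τs
  relabels ρ inj []       = []
  relabels ρ inj (E ∷ Es) = ⊢-relabel ρ inj E ∷ relabels ρ inj Es

-- `zipWith` stops at the shorter list; equal lengths ensure that every component is matched with a
-- call and an equation.
calls-unified : ∀ {S M} {calls : List Call} {τs} →
                All (λ c → env c ⊢₂ M ∶ ⌊ type c ⌋) calls →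
                length calls ≡ length τs →
                All (Unifies S) (zipWith _≐_ (map type calls) τs) →
                Pointwise (λ Γ τ → Γ ⊢₂ M ∶ ⌊ τ ⌋) (map (S $ₑ_) (map env calls)) (map (S $₀_) τs)
calls-unified {τs = []}    []       _  _        = []
calls-unified {S} {calls = c ∷ _} {τs = _ ∷ _} (D ∷ Ds) eq (u ∷ us) =
  ⊢-cast refl refl (≡-trans ($₂-⌊⌋ S (type c)) (cong ⌊_⌋ u)) (⊢-$ S D)
  ∷ calls-unified Ds (suc-injective eq) us

infer-sound  : ∀ {V M Γ σ} → Infer V M Γ σ → Γ ⊢₂ M ∶ σ
infers-sound : ∀ {M} {calls : List Call} →
               All (λ c → Infer (vars c) M (env c) ⌊ type c ⌋) calls →
               All (λ c → env c ⊢₂ M ∶ ⌊ type c ⌋) calls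

infer-sound (var {α = α}) = axiom {τ = tv α}
infer-sound (abs-⊸ I x∈) = ⊸-intro (⊢-∖ x∈ (infer-sound I))
infer-sound (abs-→ I x∈) = →-intro (⊢-∖ x∈ (infer-sound I))
infer-sound (app-var {Γ₁ = Γ₁} {Γ₂} {τ₂ = τ₂} {S} I₁ I₂ _ U) with UNIFY-unifies U
... | u₁ ∷ u₂ ∷ [] =
  -- `u₁` turns the type variable of the function into an arrow from the image of `α₂` to that of
  -- `α₃`, and `u₂` gives the argument the image of `α₂` as its type.
  ⊢-cast (sym ($ₑ-⊕ S Γ₁ Γ₂)) refl refl
    (⊢-⊸-elim-⊕ (⊢-cast refl refl (cong ⌊_⌋ u₁) (⊢-$ S (infer-sound I₁)))
                (⊢-cast refl refl (≡-trans ($₂-⌊⌋ S τ₂) (cong ⌊_⌋ u₂)) (⊢-$ S (infer-sound I₂))))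
infer-sound (app-→ {Γ₁ = Γ₁} {τ = τ} {τ⃗} {S = S} {calls} I len Is _ U) =
  ⊢-cast (sym (≡-trans ($ₑ-⊕ S Γ₁ (⨁ (map env calls)))
                       (cong ((S $ₑ Γ₁) ⊕_) (act-⨁ (λ eq → eq) (map-⁺++⁺ (S $₀_)) (map env calls)))))
         refl refl
    (⊢-→-elim-⊕ (⊢-$ S (infer-sound I)) (calls-unified (infers-sound Is) len (UNIFY-unifies U)))
infer-sound (app-⊸ {Γ₁ = Γ₁} {Γ₂} {τ₂ = τ₂} {S} I₁ I₂ _ U) with UNIFY-unifies U
... | u ∷ [] =
  ⊢-cast (sym ($ₑ-⊕ S Γ₁ Γ₂)) refl refl
    (⊢-⊸-elim-⊕ (⊢-$ S (infer-sound I₁))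
                (⊢-cast refl refl (≡-trans ($₂-⌊⌋ S τ₂) (cong ⌊_⌋ u)) (⊢-$ S (infer-sound I₂))))
infer-sound (types-mod-≈ Γ≈ σ≈ I) = types-mod-≈ Γ≈ σ≈ (infer-sound I)

infers-sound []       = []
infers-sound (I ∷ Is) = infer-sound I ∷ infers-sound Is

theorem32 : ∀ (M : Λ) (Γ : Env) (σ : T₂) → Consistent Γ → 𝖳⟨ M ⟩≡⟨ Γ , σ ⟩ → Γ ⊢₂ M ∶ σ
theorem32 M Γ σ _ (_ , I) = infer-sound I
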